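{- Let $\theta\in(0,1]$, $(a_n)_{n=1}^\infty=\mathcal{G}(\theta)$, and $e_m=\theta-\sum_{n=1}^m 1/a_n$ for $m\geqslant 0$. Fix an integer $N\geqslant 2$, and for each $m\geqslant 1$ let $N/b_m$ (with $b_m\in\mathbb{N}$) be the largest fraction with numerator $N$ and positive integer denominator that is strictly smaller than $e_{m-1}$. If $\theta$ is rational, then for all sufficiently large $m$, $$\frac{1}{a_m}<\frac{N}{b_m}.$$
   Context: $\mathbb{N}$ is the set of positive integers. For $\theta\in(0,1]$ let $G(\theta)=\lfloor 1/\theta\rfloor+1$. The greedy algorithm $\mathcal{G}$ produces the sequence $\mathcal{G}(\theta)=(a_n)_{n=1}^\infty$ of positive integers defined by $a_1=G(\theta)$ and $a_m=G\left(\theta-\sum_{n=1}^{m-1}1/a_n\right)$ for $m\geqslant 2$. -}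

module Defs where

open import Data.Nat.Base as ℕ using (ℕ; zero; suc; NonZero)
open import Data.Integer.Base as ℤ using (+_; +[1+_]; ∣_∣)
import Data.Integer.Properties as ℤ
import Data.Integer.DivMod as ℤ
open import Data.Rational.Base hiding (∣_∣; NonZero)
open import Data.Rational.Properties
import Data.Rational.Unnormalised.Base as ℚᵘ
import Data.Rational.Unnormalised.Properties as ℚᵘ
open import Relation.Binary.PropositionalEquality using (_≡_; refl; sym; trans; cong; subst₂)

-- ∣_∣ only serves to land in ℕ: the floor of 1/θ is never negative here.
G : (θ : ℚ) → .{{Positive θ}} → ℕ
G θ = suc ∣ floor ((1/ θ) {{pos⇒nonZero θ}}) ∣

1/G<θ : (θ : ℚ) .{{_ : Positive θ}} → + 1 / G θ < θ
1/G<θ θ@(mkℚ +[1+ k ] d-1 _) =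
  toℚᵘ-cancel-< (ℚᵘ.<-respˡ-≃ (ℚᵘ.≃-sym (toℚᵘ-fromℚᵘ (ℚᵘ.mkℚᵘ (+ 1) (ℕ.pred (G θ))))) (ℚᵘ.*<* cross))
  where
  d = suc d-1
  quotient : ∣ (+ d) ℤ./ (+ suc k) ∣ ≡ d ℕ./ suc k
  quotient = cong ∣_∣ (ℤ.div-pos-is-/ℕ (+ d) (suc k))

  cross : + 1 ℤ.* + d ℤ.< +[1+ k ] ℤ.* + G θ
  cross = subst₂ ℤ._<_
    (sym (ℤ.*-identityˡ (+ d)))
    (trans (ℤ.*-comm (+ suc (d ℕ./ suc k)) +[1+ k ])
           (cong (λ q → +[1+ k ] ℤ.* + suc q) (sym quotient)))
    (ℤ.n<s[n/ℕd]*d (+ d) (suc k))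

p<q⇒0<q-p : ∀ {p q} → p < q → Positive (q - p)
p<q⇒0<q-p {p} {q} p<q = positive (subst₂ _<_ (+-inverseʳ p) refl (+-monoˡ-< (- p) p<q))

p+[q-p]≡q : ∀ p q → p + (q - p) ≡ q
p+[q-p]≡q p q = trans (+-comm p (q - p))
  (trans (+-assoc q (- p) p) (trans (cong (λ r → q + r) (+-inverseˡ p)) (+-identityʳ q)))

-- 𝒢 θ n is aₙ (with n ⩾ 1), partialSum θ m is 1/a₁ + ⋯ + 1/aₘ, and e θ m is θ minus
-- that sum. G is only defined at positive arguments, so positivity of the
-- remainders is proved simultaneously.
𝒢          : (θ : ℚ) .{{_ : Positive θ}} (n : ℕ) .{{_ : NonZero n}} → ℕ
partialSum : (θ : ℚ) .{{_ : Positive θ}} → ℕ → ℚ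
e          : (θ : ℚ) .{{_ : Positive θ}} → ℕ → ℚ
e-positive : (θ : ℚ) .{{_ : Positive θ}} (m : ℕ) → Positive (e θ m)
𝒢-nonZero  : (θ : ℚ) .{{_ : Positive θ}} (n : ℕ) .{{_ : NonZero n}} → NonZero (𝒢 θ n)

𝒢 θ (suc m) = G (e θ m) {{e-positive θ m}}

partialSum θ zero    = 0ℚ
partialSum θ (suc m) = partialSum θ m + (+ 1 / 𝒢 θ (suc m)) {{𝒢-nonZero θ (suc m)}}

e θ m = θ - partialSum θ m

𝒢-nonZero θ (suc _) = _

e-positive θ {{θ>0}} zero = positive (subst₂ _<_ refl (sym (+-identityʳ θ)) (positive⁻¹ θ {{θ>0}}))
e-positive θ (suc m) = p<q⇒0<q-p (subst₂ _<_ refl (p+[q-p]≡q (partialSum θ m) θ)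
  (+-monoʳ-< (partialSum θ m) (1/G<θ (e θ m) {{e-positive θ m}})))

record IsLargestFractionBelow (x : ℚ) (N b : ℕ) .{{_ : NonZero b}} : Set where
  field
    below   : + N / b < x
    largest : ∀ c .{{_ : NonZero c}} → + N / c < x → + N / c ≤ + N / b

{-# OPTIONS --safe #-}

-- Write a remainder in lowest terms as p/q. Subtracting 1/G(p/q) = 1/(⌊q/p⌋+1) leaves a fraction
-- with numerator p ∸ q mod p, which is smaller than p unless p divides q, that is, unless p = 1;
-- and p = 1 reproduces itself. So for rational θ the remainders are eventually of the form 1/k.
-- Then a = k + 1, while N/(Nk+1) is strictly below 1/k and, since N ≥ 2, strictly above 1/(k+1).

module Submission where

open import Defs
open import Data.Nat.Base as ℕ using (ℕ; zero; suc; s≤s; NonZero)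
import Data.Nat.Properties as ℕ
import Data.Nat.DivMod as ℕ
open import Data.Nat.Divisibility using (divides; ∣⇒≤; ∣-refl; m%n≡0⇒n∣m)
open import Data.Nat.Coprimality using (Coprime; recompute)
import Data.Nat.GCD as ℕ
open import Data.Integer.Base as ℤ using (+_; +[1+_]; ∣_∣)
import Data.Integer.Properties as ℤ
import Data.Integer.DivMod as ℤ
open import Data.Integer.Tactic.RingSolver using (solve)
open import Data.List.Base using ([]; _∷_)
open import Data.Rational.Base using (ℚ; mkℚ; Positive; 1ℚ; _≤_; _<_; _/_; _+_; _-_; -_; ↥_; toℚᵘ)
open import Data.Rational.Properties
import Data.Rational.Unnormalised.Base as ℚᵘ
import Data.Rational.Unnormalised.Properties as ℚᵘ
open import Data.Product.Base using (∃-syntax; _,_)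
open import Relation.Binary.PropositionalEquality
open import Relation.Nullary.Negation.Core using (contradiction)

toℚᵘ-/ : ∀ i n .{{_ : NonZero n}} → toℚᵘ (i / n) ℚᵘ.≃ (i ℚᵘ./ n)
toℚᵘ-/ i (suc n) = toℚᵘ-fromℚᵘ (ℚᵘ.mkℚᵘ i n)

i*n<j*m⇒i/m<j/n : ∀ i m j n .{{_ : NonZero m}} .{{_ : NonZero n}} →
                  i ℕ.* n ℕ.< j ℕ.* m → + i / m < + j / n
i*n<j*m⇒i/m<j/n i m@(suc _) j n@(suc _) lt = toℚᵘ-cancel-<
  (ℚᵘ.<-respˡ-≃ (ℚᵘ.≃-sym (toℚᵘ-/ (+ i) m))
  (ℚᵘ.<-respʳ-≃ (ℚᵘ.≃-sym (toℚᵘ-/ (+ j) n))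
  (ℚᵘ.*<* (subst₂ ℤ._<_ (ℤ.pos-* i n) (ℤ.pos-* j m) (ℤ.+<+ lt)))))

x+y-y≡x : ∀ x y → (x + y) - y ≡ x
x+y-y≡x x y = trans (+-assoc x y (- y)) (trans (cong (_+_ x) (+-inverseʳ y)) (+-identityʳ x))

-- Over the common denominator qg the difference has numerator pg - q, which is r; the additive
-- hypothesis avoids truncated subtraction. The proof adds 1/g back to r/(qg) and cancels.
p/q-1/g : ∀ p q g r .{{_ : NonZero q}} .{{_ : NonZero g}} → q ℕ.+ r ≡ p ℕ.* g →
          + p / q - + 1 / g ≡ (+ r / (q ℕ.* g)) {{ℕ.m*n≢0 q g}}
p/q-1/g p q@(suc _) g@(suc _) r q+r≡pg =
  trans (cong (_- + 1 / g) (sym sum)) (x+y-y≡x (+ r / (q ℕ.* g)) (+ 1 / g))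
  where
  -- The cross-multiplied form of r/(qg) + 1/g = p/q, in the shape that `ℚᵘ.*≡*` expects.
  identity : ∀ P Q H R → Q ℤ.+ R ≡ P ℤ.* H →
             (R ℤ.* H ℤ.+ + 1 ℤ.* (Q ℤ.* H)) ℤ.* Q ≡ P ℤ.* (Q ℤ.* H ℤ.* H)
  identity P Q H R eq = begin
    (R ℤ.* H ℤ.+ + 1 ℤ.* (Q ℤ.* H)) ℤ.* Q  ≡⟨ solve (Q ∷ H ∷ R ∷ []) ⟩
    (Q ℤ.+ R) ℤ.* (Q ℤ.* H)                ≡⟨ cong (ℤ._* (Q ℤ.* H)) eq ⟩
    P ℤ.* H ℤ.* (Q ℤ.* H)                  ≡⟨ solve (P ∷ Q ∷ H ∷ []) ⟩
    P ℤ.* (Q ℤ.* H ℤ.* H)                  ∎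
    where open ≡-Reasoning

  sum : + r / (q ℕ.* g) + + 1 / g ≡ + p / q
  sum = toℚᵘ-injective (begin
    toℚᵘ (+ r / (q ℕ.* g) + + 1 / g)            ≈⟨ toℚᵘ-homo-+ (+ r / (q ℕ.* g)) (+ 1 / g) ⟩
    toℚᵘ (+ r / (q ℕ.* g)) ℚᵘ.+ toℚᵘ (+ 1 / g)  ≈⟨ ℚᵘ.+-cong (toℚᵘ-/ (+ r) (q ℕ.* g)) (toℚᵘ-/ (+ 1) g) ⟩
    (+ r ℚᵘ./ (q ℕ.* g)) ℚᵘ.+ (+ 1 ℚᵘ./ g)      ≈⟨ ℚᵘ.*≡* (identity (+ p) (+ q) (+ g) (+ r) (trans (cong +_ q+r≡pg) (ℤ.pos-* p g))) ⟩
    + p ℚᵘ./ q                                  ≈⟨ ℚᵘ.≃-sym (toℚᵘ-/ (+ p) q) ⟩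
    toℚᵘ (+ p / q)                              ∎)
    where open import Relation.Binary.Reasoning.Setoid ℚᵘ.≃-setoid

-- Reduction to lowest terms divides the numerator by `gcd r n`, so the new numerator divides the
-- nonzero r.
∣↥[r/n]∣≤r : ∀ r n .{{_ : NonZero r}} .{{_ : NonZero n}} → ∣ ↥ (+ r / n) ∣ ℕ.≤ r
∣↥[r/n]∣≤r r n = ∣⇒≤ (divides (ℕ.gcd r n) (begin
  r                                ≡⟨ cong ∣_∣ (↥-/ (+ r) n) ⟨
  ∣ ↥ (+ r / n) ℤ.* + ℕ.gcd r n ∣  ≡⟨ ℤ.abs-* (↥ (+ r / n)) (+ ℕ.gcd r n) ⟩
  ∣ ↥ (+ r / n) ∣ ℕ.* ℕ.gcd r n    ≡⟨ ℕ.*-comm ∣ ↥ (+ r / n) ∣ _ ⟩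
  ℕ.gcd r n ℕ.* ∣ ↥ (+ r / n) ∣    ∎))
  where open ≡-Reasoning

G-mkℚ : ∀ k d-1 .(c : Coprime (suc k) (suc d-1)) → G (mkℚ +[1+ k ] d-1 c) ≡ suc (suc d-1 ℕ./ suc k)
G-mkℚ k d-1 c = cong (λ i → suc ∣ i ∣) (ℤ.div-pos-is-/ℕ (+ suc d-1) (suc k))

-- For p = 1 both sides vanish. For p at least 2, a zero remainder would make p a common divisor of
-- p and q, so the remainder is at least 1 and the numerator drops.
coprime⇒pred[p∸q%p]≤pred² : ∀ k q → Coprime (suc k) q →
  ℕ.pred (suc k ℕ.∸ q ℕ.% suc k) ℕ.≤ ℕ.pred k
coprime⇒pred[p∸q%p]≤pred² zero    q c = ℕ.pred-mono-≤ (ℕ.m∸n≤m 1 (q ℕ.% 1))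
coprime⇒pred[p∸q%p]≤pred² p-1@(suc k) q c with q ℕ.% suc p-1 in eq
... | zero  = contradiction (c (∣-refl , m%n≡0⇒n∣m q (suc p-1) eq)) λ ()
... | suc s = ℕ.pred-mono-≤ (ℕ.m∸n≤m p-1 s)

-- The measure of descent: on positive rationals it is 0 exactly at the unit fractions, where
-- truncation in `pred` matches their persistence.
numerator-pred : ℚ → ℕ
numerator-pred x = ℕ.pred ∣ ↥ x ∣

numerator-pred-step : ∀ x .{{_ : Positive x}} →
  numerator-pred (x - + 1 / G x) ℕ.≤ ℕ.pred (numerator-pred x)
numerator-pred-step x@(mkℚ +[1+ k ] d-1 c) = begin
  numerator-pred (x - + 1 / G x)    ≡⟨ cong numerator-pred remainder ⟩
  numerator-pred (+ r / (q ℕ.* g))  ≤⟨ ℕ.pred-mono-≤ (∣↥[r/n]∣≤r r (q ℕ.* g)) ⟩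
  ℕ.pred r                          ≤⟨ coprime⇒pred[p∸q%p]≤pred² k q (recompute c) ⟩
  ℕ.pred k                          ∎
  where
  p q g r : ℕ
  p = suc k
  q = suc d-1
  g = suc (q ℕ./ p)
  -- This is pg - q, because q = (q mod p) + p(g - 1).
  r = p ℕ.∸ q ℕ.% p

  instance
    r≢0 : NonZero r
    r≢0 = ℕ.>-nonZero (ℕ.m<n⇒0<n∸m (ℕ.m%n<n q p))

  q+r≡pg : q ℕ.+ r ≡ p ℕ.* g
  q+r≡pg = begin′
    q ℕ.+ r                            ≡⟨ cong (ℕ._+ r) (ℕ.m≡m%n+[m/n]*n q p) ⟩
    q ℕ.% p ℕ.+ q ℕ./ p ℕ.* p ℕ.+ r    ≡⟨ cong (ℕ._+ r) (ℕ.+-comm (q ℕ.% p) _) ⟩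
    q ℕ./ p ℕ.* p ℕ.+ q ℕ.% p ℕ.+ r    ≡⟨ ℕ.+-assoc (q ℕ./ p ℕ.* p) _ _ ⟩
    q ℕ./ p ℕ.* p ℕ.+ (q ℕ.% p ℕ.+ r)  ≡⟨ cong (ℕ._+_ (q ℕ./ p ℕ.* p)) (ℕ.m+[n∸m]≡n (ℕ.m%n≤n q p)) ⟩
    q ℕ./ p ℕ.* p ℕ.+ p                ≡⟨ ℕ.+-comm _ p ⟩
    g ℕ.* p                            ≡⟨ ℕ.*-comm g p ⟩
    p ℕ.* g                            ∎′
    where open ≡-Reasoning renaming (begin_ to begin′_; _∎ to _∎′)

  remainder : x - + 1 / G x ≡ + r / (q ℕ.* g)
  remainder = begin′
    -- Rewriting below `suc` keeps the denominator visibly nonzero.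
    x - + 1 / G x      ≡⟨ cong (λ h → x - + 1 / suc h) (ℕ.suc-injective (G-mkℚ k d-1 c)) ⟩
    x - + 1 / g        ≡⟨ cong (_- + 1 / g) (↥p/↧p≡p x) ⟨
    + p / q - + 1 / g  ≡⟨ p/q-1/g p q g r q+r≡pg ⟩
    + r / (q ℕ.* g)    ∎′
    where open ≡-Reasoning renaming (begin_ to begin′_; _∎ to _∎′)

  open ℕ.≤-Reasoning

module _ (θ : ℚ) .{{_ : Positive θ}} where

  e-suc : ∀ m → e θ (suc m) ≡ e θ m - (+ 1 / 𝒢 θ (suc m)) {{𝒢-nonZero θ (suc m)}}
  e-suc m = trans (cong (_+_ θ) (neg-distrib-+ (partialSum θ m) 1/a))
                  (sym (+-assoc θ (- partialSum θ m) (- 1/a)))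
    where 1/a = (+ 1 / 𝒢 θ (suc m)) {{𝒢-nonZero θ (suc m)}}

  -- Each greedy step lowers the measure by at least one until it reaches 0, where it stays;
  -- truncated subtraction covers both phases.
  numerator-pred-e : ∀ m → numerator-pred (e θ m) ℕ.≤ numerator-pred (e θ 0) ℕ.∸ m
  numerator-pred-e zero    = ℕ.≤-refl
  numerator-pred-e (suc m) = begin
    numerator-pred (e θ (suc m))                                 ≡⟨ cong numerator-pred (e-suc m) ⟩
    numerator-pred (e θ m - + 1 / G (e θ m) {{e-positive θ m}})  ≤⟨ numerator-pred-step (e θ m) {{e-positive θ m}} ⟩
    ℕ.pred (numerator-pred (e θ m))                              ≤⟨ ℕ.pred-mono-≤ (numerator-pred-e m) ⟩
    ℕ.pred (numerator-pred (e θ 0) ℕ.∸ m)                        ≡⟨ ℕ.pred[m∸n]≡m∸[1+n] (numerator-pred (e θ 0)) m ⟩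
    numerator-pred (e θ 0) ℕ.∸ suc m                             ∎
    where open ℕ.≤-Reasoning

-- Such an `x` is 1/k. Maximality puts `+ N / b` above the explicit competitor N/(Nk+1), so `b` is
-- never computed.
1/G<largestFractionBelow : ∀ x .{{_ : Positive x}} → numerator-pred x ≡ 0 →
  ∀ N b .{{_ : NonZero b}} → 2 ℕ.≤ N → IsLargestFractionBelow x N b → + 1 / G x < + N / b
1/G<largestFractionBelow x@(mkℚ +[1+ 0 ] k-1 c) refl N b 2≤N isLargest = begin-strict
  + 1 / G x            ≡⟨ cong (λ h → + 1 / suc h) (trans (ℕ.suc-injective (G-mkℚ 0 k-1 c)) (ℕ.n/1≡n k)) ⟩
  + 1 / suc k          <⟨ i*n<j*m⇒i/m<j/n 1 (suc k) N (suc (N ℕ.* k)) 1/[k+1]<N/[Nk+1] ⟩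
  + N / suc (N ℕ.* k)  ≤⟨ largest (suc (N ℕ.* k)) N/[Nk+1]<x ⟩
  + N / b              ∎
  where
  open ≤-Reasoning
  open IsLargestFractionBelow isLargest
  k = suc k-1

  -- Cleared of denominators: Nk + 1 < Nk + N, which is where `2≤N` enters.
  1/[k+1]<N/[Nk+1] : 1 ℕ.* suc (N ℕ.* k) ℕ.< N ℕ.* suc k
  1/[k+1]<N/[Nk+1] = subst₂ ℕ._<_ (sym (ℕ.*-identityˡ _)) (sym (ℕ.*-suc N k))
    (ℕ.+-monoˡ-≤ (N ℕ.* k) 2≤N)

  -- N/c < 1/k means Nk < c, so Nk + 1 is the least admissible denominator.
  N/[Nk+1]<x : + N / suc (N ℕ.* k) < x
  N/[Nk+1]<x = subst (_<_ _) (↥p/↧p≡p x)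
    (i*n<j*m⇒i/m<j/n N (suc (N ℕ.* k)) 1 k (ℕ.≤-reflexive (sym (ℕ.*-identityˡ _))))

corollary1p7 : (θ : ℚ) .{{_ : Positive θ}} → θ ≤ 1ℚ →
    (N : ℕ) → 2 ℕ.≤ N →
    (b : (m : ℕ) .{{_ : NonZero m}} → ℕ) →
    .{{_ : ∀ {m} .{{_ : NonZero m}} → NonZero (b m)}} →
    (∀ m .{{_ : NonZero m}} → IsLargestFractionBelow (e θ (ℕ.pred m)) N (b m)) →
    ∃[ M ] (∀ m .{{_ : NonZero m}} → M ℕ.≤ m → (+ 1 / 𝒢 θ m) {{𝒢-nonZero θ m}} < + N / b m)
-- After as many steps as the initial measure the remainder is a unit fraction. The extra `suc` is
-- there because the m-th term is chosen from the remainder with index m - 1.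
corollary1p7 θ _ N 2≤N b isLargest = suc (numerator-pred (e θ 0)) , λ where
  (suc m) (s≤s u≤m) → 1/G<largestFractionBelow (e θ m) {{e-positive θ m}}
    (ℕ.n≤0⇒n≡0 (subst (numerator-pred (e θ m) ℕ.≤_) (ℕ.m≤n⇒m∸n≡0 u≤m) (numerator-pred-e θ m)))
    N (b (suc m)) 2≤N (isLargest (suc m))
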